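{- The extensionality principle for type 2 functionals, i.e. the sentence $$\forall\Phi^{(\mathbb N\to\mathbb N)\to\mathbb N}\,\forall f^{\mathbb N\to\mathbb N},g^{\mathbb N\to\mathbb N}\,\bigl(\forall n^{\mathbb N}(fn=gn)\to\Phi f=\Phi g\bigr)$$ of the language of $\mathrm{HA}^\omega$, is $\mathcal I^{\mathrm{cp}}$-interpretable.
   Context: $\mathrm{HA}^\omega$ is Heyting arithmetic in all finite types generated by $\sigma\to\tau$ from ground types $\mathbb N$ and $\mathbb B$ (Booleans), with combinators, $0$, successor, recursors, Boolean constants and conditionals; its only relation symbols are logical equalities $\equiv_\sigma$ at each type (the equalities in the claim are $\equiv_{\mathbb N}$). Formulas use $\bot,\wedge,\to,\forall x^\sigma,\exists x^\sigma$. Target language: the language of $\mathrm{HA}^\omega$ with the extra type constructor $\sigma\mapsto\sigma^*$ (non-empty finite subsets) and constants for singleton, union, indexed union $\bigcup_{w\in t}qw$, membership, combinators, conditionals and recursors for all these types, and $\mathrm m:\mathbb N^*\to\mathbb N$ (maximum). $\mathcal S^\omega_*$ is the structure with $\mathcal S_{\mathbb N}=\mathbb N$, $\mathcal S_{\mathbb B}=\{0,1\}$, $\mathcal S_{\rho\to\sigma}$ all functions from $\mathcal S_\rho$ to $\mathcal S_\sigma$, $\mathcal S_{\sigma^*}$ all non-empty finite subsets of $\mathcal S_\sigma$. The target theory $T$ is the set of sentences true in $\mathcal S^\omega_*$. Witnessing types are the types of the target language; witnessing terms are its terms. $\mathcal L^{\mathcal I}$ adds to the language of $\mathrm{HA}^\omega$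 a unary predicate $\mathcal I_\sigma(x^\sigma)$ for each type. Boldface letters are (possibly empty) tuples, $\forall\boldsymbol b\in\boldsymbol B$ is componentwise. $\mathcal I^{\mathrm{cp}}$ (canonical upon precise) is given by: $\langle\mathcal I_{\mathbb N}(x)\rangle^n$ is $x=n$; $\langle\mathcal I_{\mathbb B}(i)\rangle^j$ is $i=j$; and $\langle\mathcal I_{\rho\to\sigma}(h)\rangle^{\boldsymbol f,\boldsymbol g}_{\boldsymbol a,\boldsymbol d}:\equiv\forall x^\rho(\forall\boldsymbol b\in\boldsymbol g\boldsymbol a\boldsymbol d\,\langle\mathcal I_\rho(x)\rangle^{\boldsymbol a}_{\boldsymbol b}\to\langle\mathcal I_\sigma(hx)\rangle^{\boldsymbol f\boldsymbol a}_{\boldsymbol d})$. In particular, $\langle\mathcal I_{\mathbb N\to\mathbb N}(f)\rangle^g_k$ is $fk=gk$ and $\langle\mathcal I_{(\mathbb N\to\mathbb N)\to\mathbb N}(\Phi)\rangle^{\Psi,\mu}_h$ is $\forall f(\forall k\in\mu h(fk=hk)\to\Phi f=\Psi h)$, with $\mu:(\mathbb N\to\mathbb N)\to\mathbb N^*$, $\Psi:(\mathbb N\to\mathbb N)\to\mathbb N$. $\mathcal U$-interpretation of formulas of $\mathcal L^{\mathcal I}$: $\langle x\equiv_\sigma y\rangle$ is $x=y$; $\langle\bot\rangle:\equiv\bot$; $\langle A\wedge B\rangle^{\boldsymbol a,\boldsymbol c}_{\boldsymbol b,\boldsymbol d}:\equiv\langle A\rangle^{\boldsymbol a}_{\boldsymbol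 b}\wedge\langle B\rangle^{\boldsymbol c}_{\boldsymbol d}$; $\langle A\to B\rangle^{\boldsymbol f,\boldsymbol g}_{\boldsymbol a,\boldsymbol d}:\equiv\forall\boldsymbol b\in\boldsymbol g\boldsymbol a\boldsymbol d\,\langle A\rangle^{\boldsymbol a}_{\boldsymbol b}\to\langle B\rangle^{\boldsymbol f\boldsymbol a}_{\boldsymbol d}$; $\langle\forall xA\rangle^{\boldsymbol a}_{\boldsymbol b}:\equiv\forall x\langle A\rangle^{\boldsymbol a}_{\boldsymbol b}$; $\langle\exists xA\rangle^{\boldsymbol a}_{\boldsymbol B}:\equiv\exists x\forall\boldsymbol b\in\boldsymbol B\langle A\rangle^{\boldsymbol a}_{\boldsymbol b}$. $A$ is $\mathcal U$-interpretable if there are closed witnessing terms $\boldsymbol t$ with $T\vdash\forall\boldsymbol b\langle A\rangle^{\boldsymbol t}_{\boldsymbol b}$. $A^{\mathcal I}$ replaces $\forall x^\sigma(\dots)$ by $\forall x^\sigma(\mathcal I_\sigma(x)\to\dots)$ and $\exists x^\sigma(\dots)$ by $\exists x^\sigma(\mathcal I_\sigma(x)\wedge\dots)$. A sentence $A$ of $\mathrm{HA}^\omega$ is $\mathcal I^{\mathrm{cp}}$-interpretable if $A^{\mathcal I}$ is $\mathcal U$-interpretable when the atomic formulas $\mathcal I_\sigma(x)$ are interpreted by the clauses of $\mathcal I^{\mathrm{cp}}$ (that is, $x=n$ at type $\mathbb N$, $i=j$ at type $\mathbb B$, and the stated canonical clause for $\langle\mathcal I_{\rho\to\sigma}(h)\rangle^{\boldsymbol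 f,\boldsymbol g}_{\boldsymbol a,\boldsymbol d}$ at function types) and $x\equiv_\sigma y$ is interpreted as $x=y$. -}

module Defs where

open import Level using (0ℓ)
open import Data.Bool.Base using (Bool; true; false; if_then_else_)
open import Data.Empty using (⊥)
open import Data.List.Base using (List; []; _∷_; _++_; _ʳ++_; map; foldr)
open import Data.List.Extrema.Nat using (max; max-mono-⊆)
open import Data.List.NonEmpty.Base as List⁺ using (List⁺; _∷_; toList; _⁺++⁺_)
open import Data.List.Membership.Propositional using (_∈_)
import Data.List.Membership.Setoid as SetoidMembership
open import Data.List.Membership.Setoid.Properties using (∈-resp-≈)
import Data.List.Relation.Binary.Subset.Setoid as SetoidSubset
open import Data.List.Relation.Unary.All as All using (All; []; _∷_)
open import Data.List.Relation.Unary.All.Properties using (++⁻ˡ; ++⁻ʳ; map⁻)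
open import Data.List.Relation.Unary.Any using (Any; here; there)
import Data.List.Relation.Unary.Any.Properties as Anyₚ
open import Data.Nat.Base using (ℕ; zero; suc)
open import Data.Nat.Properties using (≤-refl; ≤-antisym)
open import Data.Product.Base using (_×_; _,_; proj₁; proj₂; ∃; ∃-syntax)
open import Data.Sum.Base using ([_,_]′)
open import Function.Base using (_∘_)
open import Function.Bundles using (Func; _⟨$⟩_)
open import Function.Relation.Binary.Setoid.Equality using (_⇨_)
open import Relation.Binary.Bundles using (Setoid)
open import Relation.Binary.PropositionalEquality using (_≡_; refl; cong; setoid)

------------------------------------------------------------------------
-- Syntax

-- HAω is the language of Heyting arithmetic in all finite types; target
-- extends it with finite sets.  The two share the grammar below.

data Lang : Set where
  HAω target : Lang

infixr 7 _⇒_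
infix  8 _*

data Ty : Lang → Set where
  nat  : ∀ {L} → Ty L
  bool : ∀ {L} → Ty L
  _⇒_  : ∀ {L} → Ty L → Ty L → Ty L
  _*   : Ty target → Ty target

data Const : (L : Lang) → Ty L → Set where
  K      : ∀ {L} {σ τ : Ty L} → Const L (σ ⇒ τ ⇒ σ)
  S      : ∀ {L} {ρ σ τ : Ty L} →
           Const L ((ρ ⇒ σ ⇒ τ) ⇒ (ρ ⇒ σ) ⇒ ρ ⇒ τ)
  zero   : ∀ {L} → Const L nat
  suc    : ∀ {L} → Const L (nat ⇒ nat)
  rec    : ∀ {L} {σ : Ty L} → Const L (σ ⇒ (nat ⇒ σ ⇒ σ) ⇒ nat ⇒ σ)
  true   : ∀ {L} → Const L bool
  false  : ∀ {L} → Const L bool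
  cond   : ∀ {L} {σ : Ty L} → Const L (bool ⇒ σ ⇒ σ ⇒ σ)
  single : ∀ {σ} → Const target (σ ⇒ σ *)
  union  : ∀ {σ} → Const target (σ * ⇒ σ * ⇒ σ *)
  ⋃      : ∀ {σ τ} → Const target (σ * ⇒ (σ ⇒ τ *) ⇒ τ *)
  m      : Const target (nat * ⇒ nat)

infixl 9 _·_

-- Contexts are lists of types, and variables are (de Bruijn) positions.

data Tm {L : Lang} (Γ : List (Ty L)) : Ty L → Set where
  var : ∀ {σ} → σ ∈ Γ → Tm Γ σ
  con : ∀ {σ} → Const L σ → Tm Γ σ
  _·_ : ∀ {σ τ} → Tm Γ (σ ⇒ τ) → Tm Γ σ → Tm Γ τ

pattern #0 = var (here refl)
pattern #1 = var (there (here refl))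
pattern #2 = var (there (there (here refl)))

-- Formulas over a family R of relation symbols, indexed by the types of
-- their arguments; equality at every type is always present.

infix  6 _≐_
infixr 5 _∧̇_
infixr 4 _⊃_

data Fm {L : Lang} (R : List (Ty L) → Set) (Γ : List (Ty L)) : Set where
  _≐_  : ∀ {σ} → Tm Γ σ → Tm Γ σ → Fm R Γ
  rel  : ∀ {σs} → R σs → All (Tm Γ) σs → Fm R Γ
  ⊥̇    : Fm R Γ
  _∧̇_  : Fm R Γ → Fm R Γ → Fm R Γ
  _⊃_  : Fm R Γ → Fm R Γ → Fm R Γ
  ∀̇    : ∀ σ → Fm R (σ ∷ Γ) → Fm R Γ
  ∃̇    : ∀ σ → Fm R (σ ∷ Γ) → Fm R Γ

-- The language of HAω has no relation symbols besides equality; 𝓛ᴵ has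
-- the predicates 𝓘; the target language has membership, which is a
-- relation symbol and so not available in witnessing terms.

NoRel : List (Ty HAω) → Set
NoRel _ = ⊥

data 𝓘Rel : List (Ty HAω) → Set where
  𝓘 : ∀ σ → 𝓘Rel (σ ∷ [])

data ∈Rel : List (Ty target) → Set where
  mem : ∀ σ → ∈Rel (σ ∷ σ * ∷ [])

Formula : List (Ty HAω) → Set
Formula = Fm NoRel

𝓘Formula : List (Ty HAω) → Set
𝓘Formula = Fm 𝓘Rel

TFormula : List (Ty target) → Set
TFormula = Fm ∈Rel

------------------------------------------------------------------------
-- The structure 𝓢ω*
--
-- Sets are setoids: 𝓢 (σ ⇒ τ) consists of all functions respecting
-- equality, identified when pointwise equal, and 𝓢 (σ *) consists of
-- non-empty finite enumerations, identified when they have the same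
-- elements.

module FinSubset (A : Setoid 0ℓ 0ℓ) where
  open SetoidSubset A using (_⊆_)

  infix 4 _≋_
  _≋_ : List⁺ (Setoid.Carrier A) → List⁺ (Setoid.Carrier A) → Set
  X ≋ Y = (toList X ⊆ toList Y) × (toList Y ⊆ toList X)

  P⁺ : Setoid 0ℓ 0ℓ
  P⁺ = record
    { Carrier = List⁺ (Setoid.Carrier A)
    ; _≈_     = _≋_
    ; isEquivalence = record
      { refl  = (λ p → p) , (λ p → p)
      ; sym   = λ (p , q) → q , p
      ; trans = λ (p , q) (p′ , q′) → (λ r → p′ (p r)) , (λ r → q (q′ r))
      }
    }

open FinSubset using (P⁺)

𝓢 : Ty target → Setoid 0ℓ 0ℓ
𝓢 nat     = setoid ℕ
𝓢 bool    = setoid Bool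
𝓢 (σ ⇒ τ) = 𝓢 σ ⇨ 𝓢 τ
𝓢 (σ *)   = P⁺ (𝓢 σ)

∣_∣ : Setoid 0ℓ 0ℓ → Set
∣ A ∣ = Setoid.Carrier A

module _ {A B : Setoid 0ℓ 0ℓ} where
  private
    module A = Setoid A
    module B = Setoid B

  fun : (f : ∣ A ∣ → ∣ B ∣) → (∀ {x x′} → x A.≈ x′ → f x B.≈ f x′) → Func A B
  fun f f-cong = record { to = f ; cong = f-cong }

  ≈-app : {f g : Func A B} {x y : ∣ A ∣} →
          Setoid._≈_ (A ⇨ B) f g → x A.≈ y → (f ⟨$⟩ x) B.≈ (g ⟨$⟩ y)
  ≈-app {f} f≈g x≈y = B.trans (Func.cong f x≈y) (f≈g _)

module _ {A B C : Setoid 0ℓ 0ℓ} where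
  private
    module A = Setoid A
    module B = Setoid B
    module C = Setoid C

  fun₂ : (f : ∣ A ∣ → ∣ B ∣ → ∣ C ∣) →
         (∀ {x x′ y y′} → x A.≈ x′ → y B.≈ y′ → f x y C.≈ f x′ y′) →
         Func A (B ⇨ C)
  fun₂ f f-cong = fun {A} {B ⇨ C} (λ x → fun (f x) (f-cong A.refl))
                                  (λ x≈x′ _ → f-cong x≈x′ B.refl)

module _ {A B C D : Setoid 0ℓ 0ℓ} where
  private
    module A = Setoid A
    module B = Setoid B
    module C = Setoid C
    module D = Setoid D

  fun₃ : (f : ∣ A ∣ → ∣ B ∣ → ∣ C ∣ → ∣ D ∣) →
         (∀ {x x′ y y′ z z′} → x A.≈ x′ → y B.≈ y′ → z C.≈ z′ →
          f x y z D.≈ f x′ y′ z′) →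
         Func A (B ⇨ (C ⇨ D))
  fun₃ f f-cong = fun₂ {A} {B} {C ⇨ D}
    (λ x y → fun (f x y) (f-cong A.refl B.refl))
    (λ x≈x′ y≈y′ _ → f-cong x≈x′ y≈y′ C.refl)

module _ {A : Setoid 0ℓ 0ℓ} where
  private
    module A = Setoid A
  open SetoidSubset A using (_⊆_)

  recᴺ : ∣ A ∣ → Func (setoid ℕ) (A ⇨ A) → ℕ → ∣ A ∣
  recᴺ x f zero    = x
  recᴺ x f (suc n) = (f ⟨$⟩ n) ⟨$⟩ recᴺ x f n

  recᴺ-cong : ∀ {x x′ f f′} → x A.≈ x′ → (∀ n y → ((f ⟨$⟩ n) ⟨$⟩ y) A.≈ ((f′ ⟨$⟩ n) ⟨$⟩ y)) →
              ∀ n → recᴺ x f n A.≈ recᴺ x′ f′ n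
  recᴺ-cong         x≈x′ f≈f′ zero    = x≈x′
  recᴺ-cong {f = f} {f′} x≈x′ f≈f′ (suc n) =
    ≈-app {f = f ⟨$⟩ n} {g = f′ ⟨$⟩ n} (f≈f′ n) (recᴺ-cong {f = f} {f′} x≈x′ f≈f′ n)

  single-⊆ : ∀ {x y} → x A.≈ y → (x ∷ []) ⊆ (y ∷ [])
  single-⊆ x≈y (here z≈x) = here (A.trans z≈x x≈y)

  ∪-⊆ : ∀ {X X′ Y Y′ : List⁺ ∣ A ∣} → toList X ⊆ toList X′ → toList Y ⊆ toList Y′ →
        toList (X ⁺++⁺ Y) ⊆ toList (X′ ⁺++⁺ Y′)
  ∪-⊆ {X} {X′} {Y} p q z∈ =
    [ (λ z∈X → Anyₚ.++⁺ˡ (p z∈X)) , (λ z∈Y → Anyₚ.++⁺ʳ (toList X′) (q z∈Y)) ]′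
      (Anyₚ.++⁻ (toList X) z∈)

module _ {A B : Setoid 0ℓ 0ℓ} where
  private
    module A = Setoid A
    module B = Setoid B
  open SetoidMembership A using () renaming (_∈_ to _∈ᴬ_)
  open SetoidMembership B using () renaming (_∈_ to _∈ᴮ_)

  ⋃ˢ : List⁺ ∣ A ∣ → Func A (P⁺ B) → List⁺ ∣ B ∣
  ⋃ˢ X f = List⁺.concatMap (f ⟨$⟩_) X

  ∈-⋃⁻ : ∀ X (f : Func A (P⁺ B)) {z} → z ∈ᴮ toList (⋃ˢ X f) →
         ∃[ x ] (x ∈ᴬ toList X) × (z ∈ᴮ toList (f ⟨$⟩ x))
  ∈-⋃⁻ (x ∷ xs) f z∈ =
    [ (λ z∈fx → x , here A.refl , z∈fx) , (λ z∈r → go xs (Anyₚ.concat⁻ _ z∈r)) ]′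
      (Anyₚ.++⁻ (toList (f ⟨$⟩ x)) z∈)
    where
    go : ∀ ys {z} → Any (z ∈ᴮ_) (map toList (map (f ⟨$⟩_) ys)) →
         ∃[ y ] (y ∈ᴬ (x ∷ ys)) × (z ∈ᴮ toList (f ⟨$⟩ y))
    go (y ∷ ys) (here p)  = y , there (here A.refl) , p
    go (y ∷ ys) (there p) with go ys p
    ... | w , here w≈x , q   = w , here w≈x , q
    ... | w , there w∈ys , q = w , there (there w∈ys) , q

  ∈-⋃⁺ : ∀ X (f : Func A (P⁺ B)) {x z} → x ∈ᴬ toList X → z ∈ᴮ toList (f ⟨$⟩ x) →
         z ∈ᴮ toList (⋃ˢ X f)
  ∈-⋃⁺ (x ∷ xs) f (here p)  q = Anyₚ.++⁺ˡ (proj₁ (Func.cong f p) q)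
  ∈-⋃⁺ (x ∷ xs) f (there p) q = Anyₚ.++⁺ʳ (toList (f ⟨$⟩ x)) (Anyₚ.concat⁺ (go xs p q))
    where
    go : ∀ ys {y z} → y ∈ᴬ ys → z ∈ᴮ toList (f ⟨$⟩ y) →
         Any (z ∈ᴮ_) (map toList (map (f ⟨$⟩_) ys))
    go (y ∷ ys) (here p)  q = here (proj₁ (Func.cong f p) q)
    go (y ∷ ys) (there p) q = there (go ys p q)

  open SetoidSubset A using () renaming (_⊆_ to _⊆ᴬ_)
  open SetoidSubset B using () renaming (_⊆_ to _⊆ᴮ_)

  ⋃-⊆ : ∀ {X X′} {f f′ : Func A (P⁺ B)} → toList X ⊆ᴬ toList X′ →
        (∀ x → toList (f ⟨$⟩ x) ⊆ᴮ toList (f′ ⟨$⟩ x)) →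
        toList (⋃ˢ X f) ⊆ᴮ toList (⋃ˢ X′ f′)
  ⋃-⊆ {X} {X′} {f} {f′} p q z∈ with ∈-⋃⁻ X f z∈
  ... | x , x∈X , z∈fx = ∈-⋃⁺ X′ f′ (p x∈X) (q x z∈fx)

⟦_⟧ᶜ : ∀ {σ} → Const target σ → ∣ 𝓢 σ ∣
⟦ K {σ = σ} {τ} ⟧ᶜ = fun₂ {𝓢 σ} {𝓢 τ} {𝓢 σ} (λ x y → x) (λ x≈x′ _ → x≈x′)
⟦ S {ρ = ρ} {σ} {τ} ⟧ᶜ =
  fun₃ {𝓢 (ρ ⇒ σ ⇒ τ)} {𝓢 (ρ ⇒ σ)} {𝓢 ρ} {𝓢 τ}
    (λ f g x → (f ⟨$⟩ x) ⟨$⟩ (g ⟨$⟩ x))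
    (λ {f} {f′} {g} {g′} {x} {x′} f≈f′ g≈g′ x≈x′ →
      ≈-app {𝓢 σ} {𝓢 τ} {f ⟨$⟩ x} {f′ ⟨$⟩ x′}
        (≈-app {𝓢 ρ} {𝓢 (σ ⇒ τ)} {f} {f′} f≈f′ x≈x′)
        (≈-app {𝓢 ρ} {𝓢 σ} {g} {g′} g≈g′ x≈x′))
⟦ zero ⟧ᶜ = zero
⟦ suc ⟧ᶜ = fun suc (cong suc)
⟦ rec {σ = σ} ⟧ᶜ = fun₃ {𝓢 σ} {𝓢 (nat ⇒ σ ⇒ σ)} {𝓢 nat} {𝓢 σ} recᴺ
  λ { {f} {f′} {g} {g′} {n} x≈x′ f≈f′ refl → recᴺ-cong {f = g} {g′} x≈x′ f≈f′ n }
⟦ true ⟧ᶜ = true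
⟦ false ⟧ᶜ = false
⟦ cond {σ = σ} ⟧ᶜ = fun₃ {𝓢 bool} {𝓢 σ} {𝓢 σ} {𝓢 σ}
  (λ b x y → if b then x else y)
  λ { {true} refl x≈x′ _ → x≈x′ ; {false} refl _ y≈y′ → y≈y′ }
⟦ single {σ} ⟧ᶜ = fun {𝓢 σ} {𝓢 (σ *)} List⁺.[_]
  (λ x≈y → single-⊆ {𝓢 σ} x≈y , single-⊆ {𝓢 σ} (Setoid.sym (𝓢 σ) x≈y))
⟦ union {σ} ⟧ᶜ = fun₂ {𝓢 (σ *)} {𝓢 (σ *)} {𝓢 (σ *)} _⁺++⁺_
  λ {X} {X′} {Y} {Y′} (p , p′) (q , q′) →
    ∪-⊆ {𝓢 σ} {X} {X′} {Y} {Y′} p q , ∪-⊆ {𝓢 σ} {X′} {X} {Y′} {Y} p′ q′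
⟦ ⋃ {σ} {τ} ⟧ᶜ = fun₂ {𝓢 (σ *)} {𝓢 (σ ⇒ τ *)} {𝓢 (τ *)} (⋃ˢ {𝓢 σ} {𝓢 τ})
  λ {X} {X′} {f} {f′} (p , p′) q →
    ⋃-⊆ {𝓢 σ} {𝓢 τ} {X} {X′} {f} {f′} p (λ x → proj₁ (q x)) ,
    ⋃-⊆ {𝓢 σ} {𝓢 τ} {X′} {X} {f′} {f} p′ (λ x → proj₂ (q x))
-- The default 0 does not affect the maximum of a non-empty list.
⟦ m ⟧ᶜ = fun {𝓢 (nat *)} {𝓢 nat} (λ X → max 0 (toList X))
  λ (p , p′) → ≤-antisym (max-mono-⊆ ≤-refl p) (max-mono-⊆ ≤-refl p′)

Valuation : List (Ty target) → Set
Valuation = All (λ σ → ∣ 𝓢 σ ∣)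

⟦_⟧ : ∀ {Γ σ} → Tm Γ σ → Valuation Γ → ∣ 𝓢 σ ∣
⟦ var x ⟧ v = All.lookup v x
⟦ con c ⟧ v = ⟦ c ⟧ᶜ
⟦ t · s ⟧ v = ⟦ t ⟧ v ⟨$⟩ ⟦ s ⟧ v

-- Satisfaction is Tarski's, read in the (constructive) metatheory.

infix 3 _⊨_

_⊨_ : ∀ {Γ} → Valuation Γ → TFormula Γ → Set
v ⊨ _≐_ {σ} t s               = Setoid._≈_ (𝓢 σ) (⟦ t ⟧ v) (⟦ s ⟧ v)
v ⊨ rel (mem σ) (t ∷ s ∷ [])  = SetoidMembership._∈_ (𝓢 σ) (⟦ t ⟧ v) (toList (⟦ s ⟧ v))
v ⊨ ⊥̇                         = ⊥
v ⊨ φ ∧̇ ψ                     = (v ⊨ φ) × (v ⊨ ψ)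
v ⊨ φ ⊃ ψ                     = v ⊨ φ → v ⊨ ψ
v ⊨ ∀̇ σ φ                     = ∀ (x : ∣ 𝓢 σ ∣) → x ∷ v ⊨ φ
v ⊨ ∃̇ σ φ                     = ∃ λ (x : ∣ 𝓢 σ ∣) → x ∷ v ⊨ φ

-- The target theory is the set of true sentences; being closed under
-- deduction, it proves exactly its members.

T⊢_ : TFormula [] → Set
T⊢ φ = [] ⊨ φ

------------------------------------------------------------------------
-- Tuples and substitution

wk : ∀ {Γ : List (Ty target)} {σ τ} → Tm Γ τ → Tm (σ ∷ Γ) τ
wk (var x) = var (there x)
wk (con c) = con c
wk (t · s) = wk t · wk s

-- A block of quantified variables τ₁,…,τₙ extends Γ to [τ₁,…,τₙ] ʳ++ Γ,
-- with τ₁ bound outermost.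

wk* : ∀ {Γ : List (Ty target)} τs {σ} → Tm Γ σ → Tm (τs ʳ++ Γ) σ
wk* []       t = t
wk* (τ ∷ τs) t = wk* τs (wk t)

vars : ∀ {Γ : List (Ty target)} τs → All (Tm (τs ʳ++ Γ)) τs
vars []       = []
vars (τ ∷ τs) = wk* τs #0 ∷ vars τs

∀* : ∀ {Γ} τs → TFormula (τs ʳ++ Γ) → TFormula Γ
∀* []       φ = φ
∀* (τ ∷ τs) φ = ∀̇ τ (∀* τs φ)

∀∈ : ∀ {Γ τs} → All (λ τ → Tm Γ (τ *)) τs → TFormula (τs ʳ++ Γ) → TFormula Γ
∀∈ []                 φ = φ
∀∈ (_∷_ {x = τ} B Bs) φ = ∀̇ τ (rel (mem τ) (#0 ∷ wk B ∷ []) ⊃ ∀∈ (All.map wk Bs) φ)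

infixr 6 _⇒*_
infixl 9 _·*_ _··_

_⇒*_ : List (Ty target) → Ty target → Ty target
σs ⇒* τ = foldr _⇒_ τ σs

_·*_ : ∀ {Γ σs τ} → Tm Γ (σs ⇒* τ) → All (Tm Γ) σs → Tm Γ τ
f ·* []       = f
f ·* (a ∷ as) = (f · a) ·* as

_··_ : ∀ {Γ σs τs} → All (λ τ → Tm Γ (σs ⇒* τ)) τs → All (Tm Γ) σs → All (Tm Γ) τs
fs ·· as = All.map (_·* as) fs

⌜_⌝ : Ty HAω → Ty target
⌜ nat ⌝   = nat
⌜ bool ⌝  = bool
⌜ σ ⇒ τ ⌝ = ⌜ σ ⌝ ⇒ ⌜ τ ⌝

⌜_⌝ᶜ : ∀ {σ} → Const HAω σ → Const target ⌜ σ ⌝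
⌜ K ⌝ᶜ     = K
⌜ S ⌝ᶜ     = S
⌜ zero ⌝ᶜ  = zero
⌜ suc ⌝ᶜ   = suc
⌜ rec ⌝ᶜ   = rec
⌜ true ⌝ᶜ  = true
⌜ false ⌝ᶜ = false
⌜ cond ⌝ᶜ  = cond

-- Simultaneous embedding of HAω terms in the target language and
-- substitution for their variables.

Env : List (Ty HAω) → List (Ty target) → Set
Env Γ Δ = ∀ {σ} → σ ∈ Γ → Tm Δ ⌜ σ ⌝

_[_] : ∀ {Γ Δ σ} → Tm Γ σ → Env Γ Δ → Tm Δ ⌜ σ ⌝
var x   [ e ] = e x
con c   [ e ] = con ⌜ c ⌝ᶜ
(t · s) [ e ] = (t [ e ]) · (s [ e ])

lift : ∀ {Γ Δ σ} → Env Γ Δ → Env (σ ∷ Γ) (⌜ σ ⌝ ∷ Δ)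
lift e (here refl) = #0
lift e (there x)   = wk (e x)

------------------------------------------------------------------------
-- The interpretation
--
-- W⋯ and C⋯ are the types of the tuples a and b in ⟨ A ⟩ᵃ_b; the clauses
-- for 𝓘 at function types follow those of ∀ and → .

W⊃ : (WA CA WB CB : List (Ty target)) → List (Ty target)
W⊃ WA CA WB CB = map (WA ⇒*_) WB ++ map (λ τ → (WA ++ CB) ⇒* τ *) CA

C⊃ : (WA CA WB CB : List (Ty target)) → List (Ty target)
C⊃ WA CA WB CB = WA ++ CB

mutual
  W𝓘 : Ty HAω → List (Ty target)
  W𝓘 nat     = nat ∷ []
  W𝓘 bool    = bool ∷ []
  W𝓘 (ρ ⇒ σ) = W⊃ (W𝓘 ρ) (C𝓘 ρ) (W𝓘 σ) (C𝓘 σ)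

  C𝓘 : Ty HAω → List (Ty target)
  C𝓘 nat     = []
  C𝓘 bool    = []
  C𝓘 (ρ ⇒ σ) = C⊃ (W𝓘 ρ) (C𝓘 ρ) (W𝓘 σ) (C𝓘 σ)

mutual
  W : ∀ {Γ} → 𝓘Formula Γ → List (Ty target)
  W (t ≐ s)         = []
  W (rel (𝓘 σ) _)   = W𝓘 σ
  W ⊥̇               = []
  W (A ∧̇ B)         = W A ++ W B
  W (A ⊃ B)         = W⊃ (W A) (C A) (W B) (C B)
  W (∀̇ σ A)         = W A
  W (∃̇ σ A)         = W A

  C : ∀ {Γ} → 𝓘Formula Γ → List (Ty target)
  C (t ≐ s)         = []
  C (rel (𝓘 σ) _)   = C𝓘 σ
  C ⊥̇               = []
  C (A ∧̇ B)         = C A ++ C B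
  C (A ⊃ B)         = C⊃ (W A) (C A) (W B) (C B)
  C (∀̇ σ A)         = C A
  C (∃̇ σ A)         = map _* (C A)

-- ∀ b ∈ g a d ⟨A⟩ᵃ_b → ⟨B⟩ᶠᵃ_d  from its two halves, where fg = f,g and
-- ad = a,d.

implies : ∀ {Δ} (WA CA WB CB : List (Ty target)) →
          (All (Tm (CA ʳ++ Δ)) WA → All (Tm (CA ʳ++ Δ)) CA → TFormula (CA ʳ++ Δ)) →
          (All (Tm Δ) WB → All (Tm Δ) CB → TFormula Δ) →
          All (Tm Δ) (W⊃ WA CA WB CB) → All (Tm Δ) (C⊃ WA CA WB CB) → TFormula Δ
implies {Δ} WA CA WB CB φ ψ fg ad =
  ∀∈ (All.map (_·* ad) g) (φ (All.map (wk* CA) a) (vars CA)) ⊃ ψ (f ·· a) d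
  where
  f : All (λ τ → Tm Δ (WA ⇒* τ)) WB
  f = map⁻ (++⁻ˡ (map (WA ⇒*_) WB) fg)

  g : All (λ τ → Tm Δ ((WA ++ CB) ⇒* τ *)) CA
  g = map⁻ (++⁻ʳ (map (WA ⇒*_) WB) fg)

  a : All (Tm Δ) WA
  a = ++⁻ˡ WA ad

  d : All (Tm Δ) CB
  d = ++⁻ʳ WA ad

-- ⟨ 𝓘_σ(t) ⟩ᵃ_b for canonical upon precise.

⟨𝓘_⟩ : ∀ {Δ} σ → Tm Δ ⌜ σ ⌝ → All (Tm Δ) (W𝓘 σ) → All (Tm Δ) (C𝓘 σ) → TFormula Δ
⟨𝓘 nat ⟩   x (n ∷ []) [] = x ≐ n
⟨𝓘 bool ⟩  i (j ∷ []) [] = i ≐ j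
⟨𝓘 ρ ⇒ σ ⟩ h fg ad =
  ∀̇ ⌜ ρ ⌝ (implies (W𝓘 ρ) (C𝓘 ρ) (W𝓘 σ) (C𝓘 σ)
    (⟨𝓘 ρ ⟩ (wk* (C𝓘 ρ) #0)) (⟨𝓘 σ ⟩ (wk h · #0))
    (All.map wk fg) (All.map wk ad))

-- ⟨ A ⟩ e a b is ⟨A⟩ᵃ_b with e substituted for the free variables of A.

⟨_⟩ : ∀ {Γ Δ} (A : 𝓘Formula Γ) → Env Γ Δ →
      All (Tm Δ) (W A) → All (Tm Δ) (C A) → TFormula Δ
⟨ t ≐ s ⟩              e a b   = (t [ e ]) ≐ (s [ e ])
⟨ rel (𝓘 σ) (t ∷ []) ⟩ e a b   = ⟨𝓘 σ ⟩ (t [ e ]) a b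
⟨ ⊥̇ ⟩                  e a b   = ⊥̇
⟨ A ∧̇ B ⟩              e ac bd =
  ⟨ A ⟩ e (++⁻ˡ (W A) ac) (++⁻ˡ (C A) bd) ∧̇ ⟨ B ⟩ e (++⁻ʳ (W A) ac) (++⁻ʳ (C A) bd)
⟨ A ⊃ B ⟩              e fg ad =
  implies (W A) (C A) (W B) (C B) (⟨ A ⟩ (λ x → wk* (C A) (e x))) (⟨ B ⟩ e) fg ad
⟨ ∀̇ σ A ⟩              e a b   = ∀̇ ⌜ σ ⌝ (⟨ A ⟩ (lift e) (All.map wk a) (All.map wk b))
⟨ ∃̇ σ A ⟩              e a B   =
  ∃̇ ⌜ σ ⌝ (∀∈ (All.map wk (map⁻ B))
    (⟨ A ⟩ (λ x → wk* (C A) (lift e x)) (All.map (wk* (C A) ∘ wk) a) (vars (C A))))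

UInterpretable : 𝓘Formula [] → Set
UInterpretable A =
  ∃ λ (t : All (Tm []) (W A)) →
    T⊢ ∀* (C A) (⟨ A ⟩ (λ ()) (All.map (wk* (C A)) t) (vars (C A)))

_ᴵ : ∀ {Γ} → Formula Γ → 𝓘Formula Γ
(t ≐ s) ᴵ  = t ≐ s
⊥̇ ᴵ        = ⊥̇
(A ∧̇ B) ᴵ  = A ᴵ ∧̇ B ᴵ
(A ⊃ B) ᴵ  = A ᴵ ⊃ B ᴵ
(∀̇ σ A) ᴵ  = ∀̇ σ (rel (𝓘 σ) (#0 ∷ []) ⊃ A ᴵ)
(∃̇ σ A) ᴵ  = ∃̇ σ (rel (𝓘 σ) (#0 ∷ []) ∧̇ A ᴵ)

𝓘cpInterpretable : Formula [] → Set
𝓘cpInterpretable A = UInterpretable (A ᴵ)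

{-# OPTIONS --safe #-}
-- Given canonical witnesses (Ψ , μ) of Φ, F of f and G of g, the canonicity of
-- Φ at F says that Φ takes the value Ψ F at every function agreeing with F on
-- μ F.  So challenging 𝓘(Φ) at F, and 𝓘(f) and f ≡ g at the points of μ F, gives
-- Φ f ≡ Ψ F ≡ Φ g.
module Submission where

open import Defs
open import Data.List.Base using (List)
open import Data.List.Relation.Unary.All using ([]; _∷_)
open import Data.List.Relation.Unary.Any using (here)
open import Data.Product.Base using (_,_)
open import Relation.Binary.PropositionalEquality using (refl; sym; trans)

-- λ Ψ μ F G → μ F
μAtF : ∀ {Γ : List (Ty target)} {α β γ δ} → Tm Γ (α ⇒ (β ⇒ γ) ⇒ β ⇒ δ ⇒ γ)
μAtF = con K · (con S · (con K · con K))

-- λ Ψ μ F G → { F }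
singletonF : ∀ {Γ : List (Ty target)} {α β γ δ} → Tm Γ (α ⇒ β ⇒ γ ⇒ δ ⇒ γ *)
singletonF = con K · (con K · (con S · (con K · con K) · con single))

corollary7p7 : 𝓘cpInterpretable
    (∀̇ ((nat ⇒ nat) ⇒ nat) (∀̇ (nat ⇒ nat) (∀̇ (nat ⇒ nat)
    ((∀̇ nat (#2 · #0 ≐ #1 · #0)) ⊃ (#2 · #1 ≐ #2 · #0)))))
corollary7p7 =
  -- Challenge sets for the hypotheses f ≡ g, 𝓘(g), 𝓘(f), 𝓘(Φ), in this order;
  -- the one for 𝓘(g) is arbitrary.
  (μAtF ∷ μAtF ∷ μAtF ∷ singletonF ∷ []) ,
  -- The quantifiers over `Φ`, `f`, `g` are uniform and come after the challenges, so the sets above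
  -- may depend only on `Ψ`, `μ`, `F`, `G`.
  λ Ψ μ F G Φ Φ-canonical f f-canonical g _ f≡g →
    trans
      -- Equality at function types is pointwise, so `F` lies in its singleton by `refl` at each
      -- argument.
      (Φ-canonical F (here λ _ → refl) f f-canonical)
      -- For `k` in `μ F` and `n ≡ k`, `g n ≡ f n ≡ F k`: there `g` inherits the witness `F` from
      -- `f`.
      (sym (Φ-canonical F (here λ _ → refl) g λ k k∈μF n n≡k →
        trans (sym (f≡g k k∈μF n n≡k)) (f-canonical k k∈μF n n≡k)))
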